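{- Let $m\ge1$ be an integer with $m\equiv r\pmod{12}$, $0\le r\le 11$. If $r\notin\{2,4,6,8,10\}$, then the friendship graph $F_j$ is $\mathbb{Z}_m$-cordial for every $j\in\mathbb{N}$ with $j\le\lfloor m/2\rfloor$. If $m\equiv 2\pmod{12}$, then $F_j$ is $\mathbb{Z}_m$-cordial for every $j\in\mathbb{N}$ with $j\le\lfloor m/2\rfloor-1$.
   Context: Graphs are finite, simple and undirected. For $n\in\mathbb{N}$, the friendship graph $F_n$ is the union of $n$ copies of the triangle $C_3$ joined at a single common (central) vertex. For an abelian group $A$ and a graph $G=(V,E)$, a vertex labeling $\ell:V\to A$ induces an edge labeling $\ell(\{v_1,v_2\})=\ell(v_1)+\ell(v_2)$. Let $f_V(a)=|\{v\in V:\ell(v)=a\}|$ and $f_E(a)=|\{e\in E:\ell(e)=a\}|$. The labeling is $A$-cordial if $|f_V(a_1)-f_V(a_2)|\le 1$ and $|f_E(a_1)-f_E(a_2)|\le 1$ for all $a_1,a_2\in A$; $G$ is $A$-cordial if it admits an $A$-cordial labeling. -}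

module Defs where

open import Algebra.Bundles using (AbelianGroup)
open import Data.Fin.Base using (Fin; zero; suc; toℕ; quotient; _<_)
open import Data.Fin.Properties using (toℕ-injective; toℕ-fromℕ<; toℕ<n; _≟_; _<?_)
open import Data.List.Base using (List; allFin; cartesianProduct; filter; length)
open import Data.Nat.Base as ℕ using (ℕ; NonZero; _∸_; ∣_-_∣)
open import Data.Nat.DivMod using (_%_; _mod_; m%n<n; m<n⇒m%n≡m; m%n%n≡m%n; n%n≡0; %-distribˡ-+)
import Data.Nat.Properties as ℕ
open import Data.Product.Base using (Σ-syntax; _×_; _,_)
open import Level using (0ℓ)
open import Relation.Binary.Core using (Rel)
open import Relation.Binary.Definitions using (Decidable; Symmetric; Irreflexive)
open import Relation.Binary.PropositionalEquality
  using (_≡_; _≢_; refl; sym; trans; cong; cong₂; isEquivalence; module ≡-Reasoning)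
open import Relation.Nullary.Decidable using (Dec; yes; no; _×-dec_)

record Graph : Set₁ where
  field
    order       : ℕ
    _~_         : Rel (Fin order) 0ℓ
    _~?_        : Decidable _~_
    symmetric   : Symmetric _~_
    irreflexive : Irreflexive _≡_ _~_

  Vertex : Set
  Vertex = Fin order

  vertices : List Vertex
  vertices = allFin order

  -- An undirected edge {u , v} is represented by its unique ordering with u < v.
  IsEdge : Vertex × Vertex → Set
  IsEdge (u , v) = u < v × u ~ v

  isEdge? : (e : Vertex × Vertex) → Dec (IsEdge e)
  isEdge? (u , v) = (u <? v) ×-dec (u ~? v)

  edges : List (Vertex × Vertex)
  edges = filter isEdge? (cartesianProduct vertices vertices)

-- The centre of F n is zero.  The 2n outer vertices are suc i with i : Fin (n * 2),
-- and quotient 2 i : Fin n is the triangle containing suc i.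
data FriendAdj (n : ℕ) : Rel (Fin (ℕ.suc (n ℕ.* 2))) 0ℓ where
  from-centre : ∀ {i} → FriendAdj n zero (suc i)
  to-centre   : ∀ {i} → FriendAdj n (suc i) zero
  outer       : ∀ {i j} → i ≢ j → quotient {n} 2 i ≡ quotient {n} 2 j →
                FriendAdj n (suc i) (suc j)

friendAdj? : ∀ n → Decidable (FriendAdj n)
friendAdj? n zero    zero    = no λ ()
friendAdj? n zero    (suc j) = yes from-centre
friendAdj? n (suc i) zero    = yes to-centre
friendAdj? n (suc i) (suc j) with i ≟ j | quotient {n} 2 i ≟ quotient {n} 2 j
... | yes i≡j | _      = no λ { (outer i≢j _) → i≢j i≡j }
... | no  i≢j | yes eq = yes (outer i≢j eq)
... | no  _   | no neq = no λ { (outer _ eq) → neq eq }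

friendAdj-sym : ∀ n → Symmetric (FriendAdj n)
friendAdj-sym n from-centre    = to-centre
friendAdj-sym n to-centre      = from-centre
friendAdj-sym n (outer i≢j eq) = outer (λ j≡i → i≢j (sym j≡i)) (sym eq)

friendAdj-irrefl : ∀ n → Irreflexive _≡_ (FriendAdj n)
friendAdj-irrefl n refl (outer i≢i _) = i≢i refl

F : ℕ → Graph
F n = record
  { order       = ℕ.suc (n ℕ.* 2)
  ; _~_         = FriendAdj n
  ; _~?_        = friendAdj? n
  ; symmetric   = friendAdj-sym n
  ; irreflexive = friendAdj-irrefl n
  }

-- Decidability of equality in A is what lets the label classes be counted.
module Cordiality {c ℓ} (A : AbelianGroup c ℓ)
                  (_≈?_ : Decidable (AbelianGroup._≈_ A)) (G : Graph) where
  open AbelianGroup A using (Carrier; _∙_)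
  open Graph G

  Labeling : Set c
  Labeling = Vertex → Carrier

  edgeLabel : Labeling → Vertex × Vertex → Carrier
  edgeLabel l (u , v) = l u ∙ l v

  f-V : Labeling → Carrier → ℕ
  f-V l a = length (filter (λ v → l v ≈? a) vertices)

  f-E : Labeling → Carrier → ℕ
  f-E l a = length (filter (λ e → edgeLabel l e ≈? a) edges)

  IsCordialLabeling : Labeling → Set c
  IsCordialLabeling l = ∀ a₁ a₂ → ∣ f-V l a₁ - f-V l a₂ ∣ ℕ.≤ 1
                                × ∣ f-E l a₁ - f-E l a₂ ∣ ℕ.≤ 1

  IsCordial : Set c
  IsCordial = Σ[ l ∈ Labeling ] IsCordialLabeling l

module _ (m : ℕ) .{{_ : NonZero m}} where

  infixl 6 _⊕_

  _⊕_ : Fin m → Fin m → Fin m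
  i ⊕ j = (toℕ i ℕ.+ toℕ j) mod m

  ⊖_ : Fin m → Fin m
  ⊖ i = (m ∸ toℕ i) mod m

  0# : Fin m
  0# = 0 mod m

  private
    open ≡-Reasoning

    toℕ-mod : ∀ a → toℕ (a mod m) ≡ a % m
    toℕ-mod a = toℕ-fromℕ< (m%n<n a m)

    toℕ-% : (i : Fin m) → toℕ i % m ≡ toℕ i
    toℕ-% i = m<n⇒m%n≡m (toℕ<n i)

    %-absorbˡ : ∀ a b → (a % m ℕ.+ b) % m ≡ (a ℕ.+ b) % m
    %-absorbˡ a b = begin
      (a % m ℕ.+ b) % m            ≡⟨ %-distribˡ-+ (a % m) b m ⟩
      (a % m % m ℕ.+ b % m) % m    ≡⟨ cong (λ x → (x ℕ.+ b % m) % m) (m%n%n≡m%n a m) ⟩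
      (a % m ℕ.+ b % m) % m        ≡⟨ %-distribˡ-+ a b m ⟨
      (a ℕ.+ b) % m                ∎

  ⊕-comm : ∀ i j → i ⊕ j ≡ j ⊕ i
  ⊕-comm i j = cong (_mod m) (ℕ.+-comm (toℕ i) (toℕ j))

  ⊕-assoc : ∀ i j k → (i ⊕ j) ⊕ k ≡ i ⊕ (j ⊕ k)
  ⊕-assoc i j k = toℕ-injective (begin
    toℕ ((i ⊕ j) ⊕ k)           ≡⟨ toℕ-mod _ ⟩
    (toℕ (i ⊕ j) ℕ.+ z) % m     ≡⟨ cong (λ t → (t ℕ.+ z) % m) (toℕ-mod _) ⟩
    ((x ℕ.+ y) % m ℕ.+ z) % m   ≡⟨ %-absorbˡ (x ℕ.+ y) z ⟩
    (x ℕ.+ y ℕ.+ z) % m         ≡⟨ cong (_% m) (trans (ℕ.+-assoc x y z) (ℕ.+-comm x (y ℕ.+ z))) ⟩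
    (y ℕ.+ z ℕ.+ x) % m         ≡⟨ %-absorbˡ (y ℕ.+ z) x ⟨
    ((y ℕ.+ z) % m ℕ.+ x) % m   ≡⟨ cong (λ t → (t ℕ.+ x) % m) (toℕ-mod _) ⟨
    (toℕ (j ⊕ k) ℕ.+ x) % m     ≡⟨ toℕ-mod _ ⟨
    toℕ ((j ⊕ k) ⊕ i)           ≡⟨ cong toℕ (⊕-comm (j ⊕ k) i) ⟩
    toℕ (i ⊕ (j ⊕ k))           ∎)
    where
    x = toℕ i
    y = toℕ j
    z = toℕ k

  ⊕-identityˡ : ∀ i → 0# ⊕ i ≡ i
  ⊕-identityˡ i = toℕ-injective (begin
    toℕ (0# ⊕ i)                ≡⟨ toℕ-mod _ ⟩
    (toℕ 0# ℕ.+ toℕ i) % m      ≡⟨ cong (λ t → (t ℕ.+ toℕ i) % m) (toℕ-mod 0) ⟩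
    (0 % m ℕ.+ toℕ i) % m       ≡⟨ %-absorbˡ 0 (toℕ i) ⟩
    toℕ i % m                   ≡⟨ toℕ-% i ⟩
    toℕ i                       ∎)

  ⊕-inverseˡ : ∀ i → (⊖ i) ⊕ i ≡ 0#
  ⊕-inverseˡ i = toℕ-injective (begin
    toℕ ((⊖ i) ⊕ i)                   ≡⟨ toℕ-mod _ ⟩
    (toℕ (⊖ i) ℕ.+ toℕ i) % m         ≡⟨ cong (λ t → (t ℕ.+ toℕ i) % m) (toℕ-mod _) ⟩
    ((m ∸ toℕ i) % m ℕ.+ toℕ i) % m   ≡⟨ %-absorbˡ (m ∸ toℕ i) (toℕ i) ⟩
    (m ∸ toℕ i ℕ.+ toℕ i) % m         ≡⟨ cong (_% m) (ℕ.m∸n+n≡m (ℕ.<⇒≤ (toℕ<n i))) ⟩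
    m % m                             ≡⟨ n%n≡0 m ⟩
    0                                 ≡⟨ m<n⇒m%n≡m (ℕ.>-nonZero⁻¹ m) ⟨
    0 % m                             ≡⟨ toℕ-mod 0 ⟨
    toℕ 0#                            ∎)

  ℤ/ : AbelianGroup 0ℓ 0ℓ
  ℤ/ = record
    { Carrier = Fin m
    ; _≈_     = _≡_
    ; _∙_     = _⊕_
    ; ε       = 0#
    ; _⁻¹     = ⊖_
    ; isAbelianGroup = record
      { isGroup = record
        { isMonoid = record
          { isSemigroup = record
            { isMagma = record { isEquivalence = isEquivalence ; ∙-cong = cong₂ _⊕_ }
            ; assoc   = ⊕-assoc
            }
          ; identity = ⊕-identityˡ , λ i → trans (⊕-comm i 0#) (⊕-identityˡ i)
          }
        ; inverse = ⊕-inverseˡ , λ i → trans (⊕-comm i (⊖ i)) (⊕-inverseˡ i)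
        ; ⁻¹-cong = cong ⊖_
        }
      ; comm = ⊕-comm
      }
    }

  IsℤCordial : Graph → Set
  IsℤCordial = Cordiality.IsCordial ℤ/ _≟_

{-# OPTIONS --safe #-}

-- Label the centre 0, so that the spokes carry the outer labels and the rim edges their pairwise
-- sums.  The outer labels are chosen as consecutive intervals of residues matched by translation:
-- the sums then have stride 2, and two such families of opposite parity interleave into an
-- interval.  Labelings are thus described by two cyclic intervals S (outer labels) and I (sums),
-- and cordiality of the edges says that S and I are disjoint (3j ≤ m) or cover ℤ/m (3j ≥ m).
-- Intervals, up to one gap or one extra pair, suffice except when 3j = m with j even, where S and I
-- must partition ℤ/m exactly; then 4 ∣ j, and a Skolem sequence provides the partition.
module Submission where

open import Defs
open import Data.Empty using (⊥-elim)
open import Data.Fin.Base as Fin using (Fin; zero; suc; toℕ)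
open import Data.Fin.Properties using (toℕ-injective; toℕ-fromℕ<; toℕ<n; all?; _≟_)
open import Data.List.Base
  using (List; _∷_; []; _++_; map; filter; length; tabulate; allFin; cartesianProduct)
open import Data.List.Membership.Propositional using (_∉_)
open import Data.List.Properties using (tabulate-cong; map-tabulate; map-++; map-∘; length-++)
open import Data.List.Relation.Unary.Any using (here; there)
open import Data.Nat.Base
  using (ℕ; zero; suc; NonZero; >-nonZero⁻¹; z≤n; s≤s; _+_; _*_; _≤_; _<_; _∸_; ∣_-_∣)
open import Data.Nat.DivMod
  using (_/_; _%_; _mod_; m%n<n; m<n⇒m%n≡m; [m+n]%n≡m%n; [m+kn]%n≡m%n; m≡m%n+[m/n]*n; m/n*n≤m; %-distribˡ-+)
open import Data.Nat.ListAction using (sum)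
open import Data.Nat.ListAction.Properties using (sum-++)
open import Data.Nat.Properties hiding (_≟_)
open import Data.Nat.Tactic.RingSolver using (solve; solve-∀)
open import Data.Product.Base using (_×_; _,_; proj₁; proj₂; ∃₂)
open import Data.Sum.Base using (inj₁; inj₂)
open import Data.Unit.Base using (tt)
open import Function.Base using (_∘_)
open import Relation.Binary.Definitions using (tri<; tri≈; tri>)
open import Relation.Binary.PropositionalEquality
  using (_≡_; _≢_; refl; sym; trans; cong; cong₂; subst; module ≡-Reasoning)
open import Relation.Nullary.Decidable using (Dec; yes; no; toWitness; _×-dec_)
open import Relation.Nullary.Negation using (¬_)
open import Relation.Unary using (Pred; Decidable)

-- The case 3j = m with j even is governed by parity. There are m edges, so each residue must label
-- exactly one edge. With centre label c and outer labels x, y, the edge labels c + x, c + y, x + y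
-- of a triangle add up to 2(c + x + y). For even m parity is meaningful modulo m, and the sum m(m -
-- 1)/2 of all residues is even only if 4 divides m, that is, 4 divides j. Otherwise m is 6 modulo
-- 12 and no labeling exists, whatever the centre carries; both hypotheses of the theorem avoid this
-- residue. The bound 2j < m is what allows 2j + 1 distinct vertex labels. The one case beyond it,
-- 2j = m, arises only when 12 divides m, and there one label has to be used twice without raising
-- any edge count to 3.

-- Counts of filtered lists as sums of indicators

χ : ∀ {p} {P : Set p} → Dec P → ℕ
χ (yes _) = 1
χ (no  _) = 0

χ-yes : ∀ {p} {P : Set p} (d : Dec P) → P → χ d ≡ 1
χ-yes (yes _) _ = refl
χ-yes (no ¬p) p = ⊥-elim (¬p p)

χ-no : ∀ {p} {P : Set p} (d : Dec P) → ¬ P → χ d ≡ 0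
χ-no (yes p) ¬p = ⊥-elim (¬p p)
χ-no (no _)  _  = refl

χ-cong : ∀ {p q} {P : Set p} {Q : Set q} (d : Dec P) (e : Dec Q) → (P → Q) → (Q → P) → χ d ≡ χ e
χ-cong (yes p) e f _ = sym (χ-yes e (f p))
χ-cong (no ¬p) e _ g = sym (χ-no e (¬p ∘ g))

length-filter≡sum : ∀ {a p} {A : Set a} {P : Pred A p} (P? : Decidable P) xs →
                    length (filter P? xs) ≡ sum (map (χ ∘ P?) xs)
length-filter≡sum P? []       = refl
length-filter≡sum P? (x ∷ xs) with P? x
... | yes _ = cong suc (length-filter≡sum P? xs)
... | no  _ = length-filter≡sum P? xs

sum-filter : ∀ {a p} {A : Set a} {P : Pred A p} (P? : Decidable P) (f : A → ℕ) xs →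
             sum (map f (filter P? xs)) ≡ sum (map (λ x → χ (P? x) * f x) xs)
sum-filter P? f []       = refl
sum-filter P? f (x ∷ xs) with P? x
... | yes _ = cong₂ _+_ (sym (+-identityʳ (f x))) (sum-filter P? f xs)
... | no  _ = sum-filter P? f xs

sum-cartesianProduct : ∀ {a b} {A : Set a} {B : Set b} (f : A × B → ℕ) xs ys →
  sum (map f (cartesianProduct xs ys)) ≡ sum (map (λ x → sum (map (λ y → f (x , y)) ys)) xs)
sum-cartesianProduct f []       ys = refl
sum-cartesianProduct f (x ∷ xs) ys = begin
  sum (map f (map (x ,_) ys ++ cartesianProduct xs ys))
    ≡⟨ cong sum (map-++ f (map (x ,_) ys) _) ⟩
  sum (map f (map (x ,_) ys) ++ map f (cartesianProduct xs ys))
    ≡⟨ sum-++ (map f (map (x ,_) ys)) _ ⟩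
  sum (map f (map (x ,_) ys)) + sum (map f (cartesianProduct xs ys))
    ≡⟨ cong₂ _+_ (cong sum (sym (map-∘ ys))) (sum-cartesianProduct f xs ys) ⟩
  _ ∎
  where open ≡-Reasoning

∑ : ∀ {n} → (Fin n → ℕ) → ℕ
∑ f = sum (tabulate f)

∑-cong : ∀ {n} {f g : Fin n → ℕ} → (∀ i → f i ≡ g i) → ∑ f ≡ ∑ g
∑-cong f≗g = cong sum (tabulate-cong f≗g)

∑-zero : ∀ {n} {f : Fin n → ℕ} → (∀ i → f i ≡ 0) → ∑ f ≡ 0
∑-zero {zero}  _    = refl
∑-zero {suc n} f≗0 rewrite f≗0 zero = ∑-zero (f≗0 ∘ suc)

sum-allFin : ∀ {n} (f : Fin n → ℕ) → sum (map f (allFin n)) ≡ ∑ f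
sum-allFin f = cong sum (map-tabulate (λ i → i) f)

-- Sums over intervals and over progressions of step 2

window : (ℕ → ℕ) → ℕ → ℕ → ℕ
window w b zero    = 0
window w b (suc n) = w b + window w (suc b) n

stride2 : (ℕ → ℕ) → ℕ → ℕ → ℕ
stride2 w b zero    = 0
stride2 w b (suc n) = w b + stride2 w (suc (suc b)) n

-- Numerical bounds are proved by naming the slack `k`, which leaves a polynomial identity to the
-- ring solver.
≤-offset : ∀ {a b} k → a + k ≡ b → a ≤ b
≤-offset {a} k refl = m≤m+n a k

window-++ : ∀ w b n k → window w b (n + k) ≡ window w b n + window w (b + n) k
window-++ w b zero    k = cong (λ c → window w c k) (sym (+-identityʳ b))
window-++ w b (suc n) k = begin
  w b + window w (suc b) (n + k)                         ≡⟨ cong (w b +_) (window-++ w (suc b) n k) ⟩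
  w b + (window w (suc b) n + window w (suc b + n) k)    ≡⟨ +-assoc (w b) _ _ ⟨
  w b + window w (suc b) n + window w (suc b + n) k
    ≡⟨ cong (λ c → w b + window w (suc b) n + window w c k) (sym (+-suc b n)) ⟩
  w b + window w (suc b) n + window w (b + suc n) k      ∎
  where open ≡-Reasoning

glue : ∀ w {b c} n k → b + n ≡ c → window w b n + window w c k ≡ window w b (n + k)
glue w {b} n k refl = sym (window-++ w b n k)

window-singleton : ∀ w b → window w b 1 ≡ w b
window-singleton w b = +-identityʳ (w b)

window-zero : ∀ w b n → (∀ k → k < n → w (b + k) ≡ 0) → window w b n ≡ 0
window-zero w b zero    _ = refl
window-zero w b (suc n) z = cong₂ _+_ (trans (cong w (sym (+-identityʳ b))) (z 0 (s≤s z≤n)))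
  (window-zero w (suc b) n λ k k<n → trans (cong w (sym (+-suc b k))) (z (suc k) (s≤s k<n)))

window-mono : ∀ w {b c} n k → c ≤ b → b + n ≤ c + k → window w b n ≤ window w c k
window-mono w {b} {c} n k c≤b b+n≤c+k with m≤n⇒∃[o]m+o≡n c≤b | m≤n⇒∃[o]m+o≡n b+n≤c+k
... | d , refl | e , eq = begin
  window w (c + d) n                                               ≤⟨ m≤m+n _ _ ⟩
  window w (c + d) n + window w (c + d + n) e                      ≡⟨ window-++ w (c + d) n e ⟨
  window w (c + d) (n + e)                                         ≤⟨ m≤n+m _ (window w c d) ⟩
  window w c d + window w (c + d) (n + e)                          ≡⟨ window-++ w c d (n + e) ⟨
  window w c (d + (n + e))                                         ≡⟨ cong (window w c) length≡ ⟩
  window w c k                                                     ∎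
  where
  open ≤-Reasoning
  length≡ : d + (n + e) ≡ k
  length≡ = +-cancelˡ-≡ c _ _ (trans (regroup c d n e) eq)
    where
    regroup : ∀ c d n e → c + (d + (n + e)) ≡ c + d + n + e
    regroup = solve-∀

-- With the tail left as `x`, a long right-nested chain of abutting windows collapses from the
-- inside out.
glue′ : ∀ w {b c x} n k → b + n ≡ c → x ≡ window w c k → window w b n + x ≡ window w b (n + k)
glue′ w n k b+n≡c refl = glue w n k b+n≡c

stride2-glue : ∀ w {b c} n k → b + 2 * n ≡ c → stride2 w b n + stride2 w c k ≡ stride2 w b (n + k)
stride2-glue w {b} zero    k refl = cong (λ c → stride2 w c k) (+-identityʳ b)
stride2-glue w {b} (suc n) k refl = trans (+-assoc (w b) _ _)
  (cong (w b +_) (stride2-glue w n k (shift b n)))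
  where
  shift : ∀ b n → suc (suc b) + 2 * n ≡ b + 2 * suc n
  shift = solve-∀

interleave-odd : ∀ w b q → stride2 w b (suc q) + stride2 w (suc b) q ≡ window w b (suc (q + q))
interleave-even : ∀ w b q → stride2 w b q + stride2 w (suc b) q ≡ window w b (q + q)

interleave-odd w b q = begin
  w b + stride2 w (suc (suc b)) q + stride2 w (suc b) q
    ≡⟨ +-assoc (w b) _ _ ⟩
  w b + (stride2 w (suc (suc b)) q + stride2 w (suc b) q)
    ≡⟨ cong (w b +_) (trans (+-comm _ (stride2 w (suc b) q)) (interleave-even w (suc b) q)) ⟩
  w b + window w (suc b) (q + q) ∎
  where open ≡-Reasoning

interleave-even w b zero    = refl
interleave-even w b (suc q) = begin
  stride2 w b (suc q) + (w (suc b) + stride2 w (suc (suc (suc b))) q)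
    ≡⟨ regroup (w b) _ (w (suc b)) _ ⟩
  w b + (w (suc b) + (stride2 w (suc (suc b)) q + stride2 w (suc (suc (suc b))) q))
    ≡⟨ cong (λ t → w b + (w (suc b) + t)) (interleave-even w (suc (suc b)) q) ⟩
  window w b (suc (suc (q + q)))
    ≡⟨ cong (λ n → window w b (suc n)) (+-suc q q) ⟨
  window w b (suc q + suc q) ∎
  where
  open ≡-Reasoning
  regroup : ∀ a b c d → a + b + (c + d) ≡ a + (c + (b + d))
  regroup = solve-∀

-- `w` stands for the indicator of one residue class modulo m. Taken over all classes, a total of at
-- most 1 says that no residue occurs twice, and a total of at least 1 that every residue occurs.
module Exact (w : ℕ → ℕ) (m : ℕ) (w[m]≡w[0] : w m ≡ w 0) (full : ∀ b → window w b m ≡ 1) where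

  window≤1 : ∀ b {n} → n ≤ m → window w b n ≤ 1
  window≤1 b n≤m = ≤-trans (window-mono w _ m ≤-refl (+-monoʳ-≤ b n≤m)) (≤-reflexive (full b))

  value≤1 : .{{_ : NonZero m}} → ∀ b → w b ≤ 1
  value≤1 b = ≤-trans (≤-reflexive (sym (window-singleton w b))) (window≤1 b (>-nonZero⁻¹ m))

  -- In the period beginning at `u`, the second window lies within the part that the first leaves
  -- free; `covering` rests on the reverse containment.
  disjoint : ∀ u s i n → u + s ≤ i → i + n ≤ u + m → window w u s + window w i n ≤ 1
  disjoint u s i n u+s≤i i+n≤u+m with m≤n⇒∃[o]m+o≡n (≤-trans u+s≤i (≤-trans (m≤m+n i n) i+n≤u+m))
  ... | d , u+s+d≡u+m = begin
    window w u s + window w i n        ≤⟨ +-monoʳ-≤ _ (window-mono w n d u+s≤i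
                                            (≤-trans i+n≤u+m (≤-reflexive (sym u+s+d≡u+m)))) ⟩
    window w u s + window w (u + s) d  ≡⟨ glue w s d refl ⟩
    window w u (s + d)                 ≡⟨ cong (window w u)
                                            (+-cancelˡ-≡ u _ m (trans (sym (+-assoc u s d)) u+s+d≡u+m)) ⟩
    window w u m                       ≡⟨ full u ⟩
    1                                  ∎
    where open ≤-Reasoning

  covering : ∀ u s i n → s ≤ m → i ≤ u + s → u + m ≤ i + n → 1 ≤ window w u s + window w i n
  covering u s i n s≤m i≤u+s u+m≤i+n with m≤n⇒∃[o]m+o≡n s≤m
  ... | d , refl = begin
    1                                  ≡⟨ full u ⟨
    window w u (s + d)                 ≡⟨ glue w s d refl ⟨
    window w u s + window w (u + s) d  ≤⟨ +-monoʳ-≤ _ (window-mono w d n i≤u+s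
                                            (≤-trans (≤-reflexive (+-assoc u s d)) u+m≤i+n)) ⟩
    window w u s + window w i n        ∎
    where open ≤-Reasoning

  centre+window≤1 : ∀ u s → 1 ≤ u → u + s ≤ m → w 0 + window w u s ≤ 1
  centre+window≤1 u s 1≤u u+s≤m = begin
    w 0 + window w u s           ≡⟨ +-comm (w 0) _ ⟩
    -- The centre's 0 is read as m: as 1 ≤ u, it then lies past the window but still in the period
    -- beginning at `u`.
    window w u s + w 0           ≡⟨ cong (window w u s +_) (trans (sym w[m]≡w[0]) (sym (window-singleton w m))) ⟩
    window w u s + window w m 1  ≤⟨ disjoint u s m 1 u+s≤m
                                      (≤-trans (≤-reflexive (+-comm m 1)) (+-monoˡ-≤ m 1≤u)) ⟩
    1                            ∎
    where open ≤-Reasoning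

-- Lists of triangles and the multisets of their labels

-- A list of pairs prescribes the outer labels of one triangle each, the centre being labelled 0.
Triangles : Set
Triangles = List (ℕ × ℕ)

outerLabel : (L : Triangles) → Fin (length L * 2) → ℕ
outerLabel ((x , y) ∷ L) zero          = x
outerLabel ((x , y) ∷ L) (suc zero)    = y
outerLabel ((x , y) ∷ L) (suc (suc i)) = outerLabel L i

spokes : (ℕ → ℕ) → Triangles → ℕ
spokes w []            = 0
spokes w ((x , y) ∷ L) = w x + w y + spokes w L

rims : (ℕ → ℕ) → Triangles → ℕ
rims w []            = 0
rims w ((x , y) ∷ L) = w (x + y) + rims w L

∑-outerLabel : ∀ w L → ∑ (w ∘ outerLabel L) ≡ spokes w L
∑-outerLabel w []            = refl
∑-outerLabel w ((x , y) ∷ L) =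
  trans (sym (+-assoc (w x) (w y) _)) (cong (w x + w y +_) (∑-outerLabel w L))

spokes-++ : ∀ w L M → spokes w (L ++ M) ≡ spokes w L + spokes w M
spokes-++ w []            M = refl
spokes-++ w ((x , y) ∷ L) M = trans (cong (w x + w y +_) (spokes-++ w L M)) (sym (+-assoc (w x + w y) _ _))

rims-++ : ∀ w L M → rims w (L ++ M) ≡ rims w L + rims w M
rims-++ w []            M = refl
rims-++ w ((x , y) ∷ L) M = trans (cong (w (x + y) +_) (rims-++ w L M)) (sym (+-assoc (w (x + y)) _ _))

parallel : ℕ → ℕ → ℕ → Triangles
parallel x y zero    = []
parallel x y (suc n) = (x , y) ∷ parallel (suc x) (suc y) n

length-parallel : ∀ x y n → length (parallel x y n) ≡ n
length-parallel x y zero    = refl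
length-parallel x y (suc n) = cong suc (length-parallel (suc x) (suc y) n)

spokes-parallel : ∀ w x y n → spokes w (parallel x y n) ≡ window w x n + window w y n
spokes-parallel w x y zero    = refl
spokes-parallel w x y (suc n) = trans
  (cong (w x + w y +_) (spokes-parallel w (suc x) (suc y) n))
  (+-exchange (w x) (w y) _ _)
  where
  +-exchange : ∀ a b c d → a + b + (c + d) ≡ a + c + (b + d)
  +-exchange = solve-∀

rims-parallel : ∀ w x y n → rims w (parallel x y n) ≡ stride2 w (x + y) n
rims-parallel w x y zero    = refl
rims-parallel w x y (suc n) = cong (w (x + y) +_)
  (trans (rims-parallel w (suc x) (suc y) n) (cong (λ b → stride2 w (suc b) n) (+-suc x y)))

-- The two outer and the two inner of four consecutive intervals are matched by translation;
-- the two resulting sequences of sums have stride 2 and opposite parity, so they interleave.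
block : ℕ → ℕ → Triangles
block u q = parallel u (u + (3 * q + 1)) (suc q) ++ parallel (u + suc q) (u + (2 * q + 1)) q

length-block : ∀ u q → length (block u q) ≡ 2 * q + 1
length-block u q = begin
  length (block u q)  ≡⟨ length-++ (parallel u (u + (3 * q + 1)) (suc q)) ⟩
  _                   ≡⟨ cong₂ _+_ (length-parallel u (u + (3 * q + 1)) (suc q))
                                   (length-parallel (u + suc q) (u + (2 * q + 1)) q) ⟩
  suc q + q           ≡⟨ solve (q ∷ []) ⟩
  2 * q + 1           ∎
  where open ≡-Reasoning

spokes-block : ∀ w u q → spokes w (block u q) ≡ window w u (4 * q + 2)
spokes-block w u q = begin
  spokes w (block u q)
    ≡⟨ spokes-++ w (parallel u (u + (3 * q + 1)) (suc q)) _ ⟩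
  _ ≡⟨ cong₂ _+_ (spokes-parallel w u (u + (3 * q + 1)) (suc q))
                 (spokes-parallel w (u + suc q) (u + (2 * q + 1)) q) ⟩
  (window w u (suc q) + window w (u + (3 * q + 1)) (suc q))
    + (window w (u + suc q) q + window w (u + (2 * q + 1)) q)
    ≡⟨ +-cycle (window w u (suc q)) _ (window w (u + suc q) q) _ ⟩
  window w u (suc q) + (window w (u + suc q) q
    + (window w (u + (2 * q + 1)) q + window w (u + (3 * q + 1)) (suc q)))
    ≡⟨ cong (λ t → window w u (suc q) + (window w (u + suc q) q + t)) (glue w q (suc q) (solve (u ∷ q ∷ []))) ⟩
  window w u (suc q) + (window w (u + suc q) q + window w (u + (2 * q + 1)) (q + suc q))
    ≡⟨ cong (window w u (suc q) +_) (glue w q (q + suc q) (solve (u ∷ q ∷ []))) ⟩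
  window w u (suc q) + window w (u + suc q) (q + (q + suc q))
    ≡⟨ glue w (suc q) (q + (q + suc q)) refl ⟩
  window w u (suc q + (q + (q + suc q)))
    ≡⟨ cong (window w u) (length≡ q) ⟩
  window w u (4 * q + 2) ∎
  where
  open ≡-Reasoning
  +-cycle : ∀ a b c d → a + b + (c + d) ≡ a + (c + (d + b))
  +-cycle = solve-∀
  length≡ : ∀ q → suc q + (q + (q + suc q)) ≡ 4 * q + 2
  length≡ = solve-∀

rims-block : ∀ w u q → rims w (block u q) ≡ window w (2 * u + 3 * q + 1) (2 * q + 1)
rims-block w u q = begin
  rims w (block u q)
    ≡⟨ rims-++ w (parallel u (u + (3 * q + 1)) (suc q)) _ ⟩
  _ ≡⟨ cong₂ _+_ (rims-parallel w u (u + (3 * q + 1)) (suc q))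
                 (rims-parallel w (u + suc q) (u + (2 * q + 1)) q) ⟩
  stride2 w (u + (u + (3 * q + 1))) (suc q) + stride2 w (u + suc q + (u + (2 * q + 1))) q
    ≡⟨ cong₂ (λ b c → stride2 w b (suc q) + stride2 w c q) (solve (u ∷ q ∷ [])) (solve (u ∷ q ∷ [])) ⟩
  stride2 w (2 * u + 3 * q + 1) (suc q) + stride2 w (suc (2 * u + 3 * q + 1)) q
    ≡⟨ interleave-odd w (2 * u + 3 * q + 1) q ⟩
  window w (2 * u + 3 * q + 1) (suc (q + q))
    ≡⟨ cong (window w (2 * u + 3 * q + 1)) (length≡ q) ⟩
  window w (2 * u + 3 * q + 1) (2 * q + 1) ∎
  where
  open ≡-Reasoning
  length≡ : ∀ q → suc (q + q) ≡ 2 * q + 1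
  length≡ = solve-∀

-- Nested arcs of a Skolem sequence, with positions shifted by a constant: the distance grows by 2
-- and the left end moves down by 1, so the right end, which is the sum, moves up by 1.
steep : ℕ → ℕ → ℕ → Triangles
steep x y zero    = []
steep x y (suc n) = (x , y + n) ∷ steep (suc (suc x)) y n

length-steep : ∀ x y n → length (steep x y n) ≡ n
length-steep x y zero    = refl
length-steep x y (suc n) = cong suc (length-steep (suc (suc x)) y n)

spokes-steep : ∀ w x y n → spokes w (steep x y n) ≡ stride2 w x n + window w y n
spokes-steep w x y zero    = refl
spokes-steep w x y (suc n) = begin
  w x + w (y + n) + spokes w (steep (suc (suc x)) y n)
    ≡⟨ cong (w x + w (y + n) +_) (spokes-steep w (suc (suc x)) y n) ⟩
  w x + w (y + n) + (stride2 w (suc (suc x)) n + window w y n)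
    ≡⟨ regroup (w x) (w (y + n)) _ _ ⟩
  stride2 w x (suc n) + (window w y n + (w (y + n) + 0))
    ≡⟨ cong (stride2 w x (suc n) +_) (glue w n 1 refl) ⟩
  stride2 w x (suc n) + window w y (n + 1)
    ≡⟨ cong (λ k → stride2 w x (suc n) + window w y k) (+-comm n 1) ⟩
  stride2 w x (suc n) + window w y (suc n) ∎
  where
  open ≡-Reasoning
  regroup : ∀ a b c d → a + b + (c + d) ≡ a + c + (d + (b + 0))
  regroup = solve-∀

-- `c` is the first sum x + y + (n - 1), given through its successor to avoid subtraction.
rims-steep : ∀ w x y n {c} → x + y + n ≡ suc c → rims w (steep x y n) ≡ window w c n
rims-steep w x y zero    _  = refl
rims-steep w x y (suc n) {c} eq = cong₂ _+_ (cong w first) (rims-steep w (suc (suc x)) y n rest)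
  where
  first : x + (y + n) ≡ c
  first = suc-injective (trans (sym (cong suc (+-assoc x y n))) (trans (sym (+-suc (x + y) n)) eq))
  rest : suc (suc x) + y + n ≡ suc (suc c)
  rest = cong suc (trans (sym (+-suc (x + y) n)) eq)

-- Rim edges of the friendship graph

isEdgeF? : ∀ n u v → Dec (Graph.IsEdge (F n) (u , v))
isEdgeF? n u v = Graph.isEdge? (F n) (u , v)

-- Dropping the first triangle lowers the index of each remaining outer vertex by 2 and its
-- `quotient 2` by 1.
isEdgeF?-suc : ∀ n i j →
  χ (isEdgeF? (suc n) (suc (suc (suc i))) (suc (suc (suc j)))) ≡ χ (isEdgeF? n (suc i) (suc j))
isEdgeF?-suc n i j = χ-cong (isEdgeF? (suc n) _ _) (isEdgeF? n _ _) to from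
  where
  to : Graph.IsEdge (F (suc n)) (suc (suc (suc i)) , suc (suc (suc j))) →
       Graph.IsEdge (F n) (suc i , suc j)
  to (s≤s (s≤s i<j) , outer i≢j eq) =
    i<j , outer (λ i≡j → i≢j (cong (λ k → suc (suc k)) i≡j)) (suc-inj eq)
    where
    suc-inj : ∀ {n} {a b : Fin n} → Fin.suc a ≡ suc b → a ≡ b
    suc-inj refl = refl
  from : Graph.IsEdge (F n) (suc i , suc j) →
         Graph.IsEdge (F (suc n)) (suc (suc (suc i)) , suc (suc (suc j)))
  from (i<j , outer i≢j eq) =
    s≤s (s≤s i<j) , outer (λ { refl → i≢j refl }) (cong suc eq)

χ*-zero : ∀ {p} {P : Set p} (d : Dec P) k → ¬ P → χ d * k ≡ 0
χ*-zero d k ¬p = cong (_* k) (χ-no d ¬p)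

χ*-one : ∀ {p} {P : Set p} (d : Dec P) k → P → χ d * k ≡ k
χ*-one d k p = trans (cong (_* k) (χ-yes d p)) (*-identityˡ k)

-- An edge is counted only in the row of its smaller end. So the row of the first outer vertex
-- contributes the rim of the first triangle, the second row nothing, and the others reduce to `L`.
∑-rims : ∀ w L →
  ∑ (λ i → ∑ λ j → χ (isEdgeF? (length L) (suc i) (suc j)) * w (outerLabel L i + outerLabel L j))
  ≡ rims w L
∑-rims w []                = refl
∑-rims w L′@((x , y) ∷ L) = begin
  ∑ (row zero) + (∑ (row (suc zero)) + ∑ (λ i → ∑ (row (suc (suc i)))))
    ≡⟨ cong₂ _+_ row₀ (cong₂ _+_ row₁ rows) ⟩
  w (x + y) + (0 + rims w L)
    ∎
  where
  open ≡-Reasoning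
  n = length L′
  row : Fin (n * 2) → Fin (n * 2) → ℕ
  row i j = χ (isEdgeF? n (suc i) (suc j)) * w (outerLabel L′ i + outerLabel L′ j)

  vanish : ∀ i j → ¬ Graph.IsEdge (F n) (suc i , suc j) → row i j ≡ 0
  vanish i j = χ*-zero (isEdgeF? n (suc i) (suc j)) _

  row₀ : ∑ (row zero) ≡ w (x + y)
  row₀ = begin
    row zero zero + (row zero (suc zero) + ∑ (λ j → row zero (suc (suc j))))
      ≡⟨ cong₂ _+_ (vanish zero zero λ { (s≤s () , _) })
           (cong₂ _+_ (χ*-one (isEdgeF? n (suc zero) (suc (suc zero))) _
                        (s≤s (s≤s z≤n) , outer (λ ()) refl))
             (∑-zero λ j → vanish zero (suc (suc j)) λ { (_ , outer _ ()) })) ⟩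
    w (x + y) + 0
      ≡⟨ +-identityʳ _ ⟩
    w (x + y) ∎

  row₁ : ∑ (row (suc zero)) ≡ 0
  row₁ = ∑-zero {f = row (suc zero)} λ
    { zero          → vanish (suc zero) zero λ { (s≤s () , _) }
    ; (suc zero)    → vanish (suc zero) (suc zero) λ { (s≤s (s≤s ()) , _) }
    ; (suc (suc j)) → vanish (suc zero) (suc (suc j)) λ { (_ , outer _ ()) }
    }

  rows : ∑ (λ i → ∑ (row (suc (suc i)))) ≡ rims w L
  rows = trans
    (∑-cong λ i → cong₂ _+_ (vanish (suc (suc i)) zero λ { (s≤s () , _) })
      (cong₂ _+_ (vanish (suc (suc i)) (suc zero) λ { (s≤s (s≤s ()) , _) })
        (∑-cong λ j → cong (_* w (outerLabel L i + outerLabel L j)) (isEdgeF?-suc (length L) i j))))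
    (∑-rims w L)

∣m-n∣≤1 : ∀ {b m n} → b ≤ m → m ≤ suc b → b ≤ n → n ≤ suc b → ∣ m - n ∣ ≤ 1
∣m-n∣≤1 {b} {m} {n} b≤m m≤1+b b≤n n≤1+b with ≤-total m n
... | inj₁ m≤n rewrite m≤n⇒∣m-n∣≡n∸m m≤n =
  ≤-trans (∸-mono n≤1+b b≤m) (≤-reflexive (m+n∸n≡m 1 b))
... | inj₂ n≤m rewrite ∣-∣-comm m n | m≤n⇒∣m-n∣≡n∸m n≤m =
  ≤-trans (∸-mono m≤1+b b≤n) (≤-reflexive (m+n∸n≡m 1 b))

-- From lists of triangles to labelings modulo m

module _ (m : ℕ) .{{_ : NonZero m}} where

  toℕ-mod : ∀ x → toℕ (x mod m) ≡ x % m
  toℕ-mod x = toℕ-fromℕ< (m%n<n x m)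

  residue : Fin m → ℕ → ℕ
  residue a x = χ ((x mod m) ≟ a)

  mod-+ : ∀ x y → _⊕_ m (x mod m) (y mod m) ≡ (x + y) mod m
  mod-+ x y = toℕ-injective (begin
    toℕ ((toℕ (x mod m) + toℕ (y mod m)) mod m)  ≡⟨ toℕ-mod _ ⟩
    (toℕ (x mod m) + toℕ (y mod m)) % m          ≡⟨ cong₂ (λ a b → (a + b) % m) (toℕ-mod x) (toℕ-mod y) ⟩
    (x % m + y % m) % m                          ≡⟨ %-distribˡ-+ x y m ⟨
    (x + y) % m                                  ≡⟨ toℕ-mod _ ⟨
    toℕ ((x + y) mod m)                          ∎)
    where
    open ≡-Reasoning

  residue-periodic : ∀ a b → residue a (b + m) ≡ residue a b
  residue-periodic a b = cong (λ i → χ (i ≟ a)) (toℕ-injective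
    (trans (toℕ-mod (b + m)) (trans ([m+n]%n≡m%n b m) (sym (toℕ-mod b)))))

  residue-≡ : ∀ a {x} → x < m → x ≡ toℕ a → residue a x ≡ 1
  residue-≡ a x<m x≡a = χ-yes _ (toℕ-injective (trans (toℕ-mod _) (trans (m<n⇒m%n≡m x<m) x≡a)))

  residue-≢ : ∀ a {x} → x < m → x ≢ toℕ a → residue a x ≡ 0
  residue-≢ a x<m x≢a = χ-no _ λ eq →
    x≢a (trans (sym (m<n⇒m%n≡m x<m)) (trans (sym (toℕ-mod _)) (cong toℕ eq)))

  -- Among 0, ..., m - 1 only `toℕ a` counts; sliding the window by one trades `b` for `b + m`,
  -- which lies in the same class.
  window-residue : ∀ a b → window (residue a) b m ≡ 1
  window-residue a zero with m≤n⇒∃[o]m+o≡n (toℕ<n a)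
  ... | d , eq = begin
    window w 0 m
      ≡⟨ cong (window w 0) (trans (+-suc (toℕ a) d) eq) ⟨
    window w 0 (toℕ a + suc d)
      ≡⟨ window-++ w 0 (toℕ a) (suc d) ⟩
    window w 0 (toℕ a) + (w (toℕ a) + window w (suc (toℕ a)) d)
      ≡⟨ cong₂ _+_
           (window-zero w 0 (toℕ a) λ k k<a → residue-≢ a (<-trans k<a (toℕ<n a)) (<⇒≢ k<a))
           (cong₂ _+_ (residue-≡ a (toℕ<n a) refl)
             (window-zero w (suc (toℕ a)) d λ k k<d →
               residue-≢ a (<-≤-trans (+-monoʳ-< (suc (toℕ a)) k<d) (≤-reflexive eq))
                 (>⇒≢ (s≤s (m≤m+n (toℕ a) k))))) ⟩
    1 ∎
    where
    open ≡-Reasoning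
    w = residue a
  window-residue a (suc b) = +-cancelˡ-≡ (w b) _ _ (begin
    window w b (suc m)      ≡⟨ cong (window w b) (+-comm 1 m) ⟩
    window w b (m + 1)      ≡⟨ window-++ w b m 1 ⟩
    window w b m + (w (b + m) + 0)
      ≡⟨ cong₂ _+_ (window-residue a b) (trans (+-identityʳ _) (residue-periodic a b)) ⟩
    1 + w b                 ≡⟨ +-comm 1 (w b) ⟩
    w b + 1                 ∎)
    where
    open ≡-Reasoning
    w = residue a

  module Residue (a : Fin m) = Exact (residue a) m (residue-periodic a 0) (window-residue a)

  module _ (L : Triangles) where
    open Cordiality (ℤ/ m) _≟_ (F (length L))

    naturalLabel : Fin (suc (length L * 2)) → ℕ
    naturalLabel zero    = 0
    naturalLabel (suc i) = outerLabel L i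

    labeling : Labeling
    labeling v = naturalLabel v mod m

    f-V≡ : ∀ a → f-V labeling a ≡ residue a 0 + spokes (residue a) L
    f-V≡ a = begin
      f-V labeling a
        ≡⟨ length-filter≡sum (λ v → labeling v ≟ a) (allFin _) ⟩
      sum (map (residue a ∘ naturalLabel) (allFin _))
        ≡⟨ sum-allFin (residue a ∘ naturalLabel) ⟩
      residue a 0 + ∑ (residue a ∘ outerLabel L)
        ≡⟨ cong (residue a 0 +_) (∑-outerLabel (residue a) L) ⟩
      residue a 0 + spokes (residue a) L ∎
      where open ≡-Reasoning

    f-E≡ : ∀ a → f-E labeling a ≡ spokes (residue a) L + rims (residue a) L
    f-E≡ a = begin
      f-E labeling a
        ≡⟨ length-filter≡sum (λ e → edgeLabel labeling e ≟ a) (Graph.edges (F n)) ⟩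
      sum (map (λ e → χ (edgeLabel labeling e ≟ a)) (Graph.edges (F n)))
        ≡⟨ sum-filter (Graph.isEdge? (F n)) _ (cartesianProduct (allFin _) (allFin _)) ⟩
      sum (map weight (cartesianProduct (allFin _) (allFin _)))
        ≡⟨ sum-cartesianProduct weight (allFin _) (allFin _) ⟩
      sum (map (λ u → sum (map (λ v → weight (u , v)) (allFin _))) (allFin _))
        ≡⟨ sum-allFin (λ u → sum (map (λ v → weight (u , v)) (allFin _))) ⟩
      ∑ (λ u → sum (map (λ v → weight (u , v)) (allFin _)))
        ≡⟨ ∑-cong (λ u → sum-allFin (λ v → weight (u , v))) ⟩
      ∑ (λ u → ∑ λ v → weight (u , v))
        ≡⟨ ∑-cong (λ u → ∑-cong λ v → cong (λ z → χ (isEdgeF? n u v) * χ (z ≟ a))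
             (mod-+ (naturalLabel u) (naturalLabel v))) ⟩
      ∑ (λ u → ∑ λ v → χ (isEdgeF? n u v) * residue a (naturalLabel u + naturalLabel v))
        ≡⟨ cong₂ _+_ centreRow outerRows ⟩
      spokes (residue a) L + rims (residue a) L ∎
      where
      open ≡-Reasoning
      n = length L
      weight : Fin (suc (n * 2)) × Fin (suc (n * 2)) → ℕ
      weight e = χ (Graph.isEdge? (F n) e) * χ (edgeLabel labeling e ≟ a)

      centreRow : ∑ (λ v → χ (isEdgeF? n zero v) * residue a (naturalLabel v)) ≡ spokes (residue a) L
      centreRow = trans
        (cong₂ _+_ (χ*-zero (isEdgeF? n zero zero) (residue a 0) λ { (() , _) })
          (∑-cong λ i → χ*-one (isEdgeF? n zero (suc i)) _ (s≤s z≤n , from-centre)))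
        (∑-outerLabel (residue a) L)

      outerRows : ∑ (λ i → ∑ λ v → χ (isEdgeF? n (suc i) v) *
                    residue a (outerLabel L i + naturalLabel v)) ≡ rims (residue a) L
      outerRows = trans
        (∑-cong λ i → cong (_+ ∑ (λ j → χ (isEdgeF? n (suc i) (suc j)) *
                                   residue a (outerLabel L i + outerLabel L j)))
          (χ*-zero (isEdgeF? n (suc i) zero) (residue a (outerLabel L i + 0)) λ { (() , _) }))
        (∑-rims (residue a) L)

    -- `v` and `e` record the regime: `v` is 0 for distinct vertex labels and 1 when 2j = m; `e` is
    -- 0 for distinct edge labels and 1 when every residue labels an edge.
    cordial : ∀ {j} → length L ≡ j → ∀ v e →
      (∀ a → v ≤ residue a 0 + spokes (residue a) L × residue a 0 + spokes (residue a) L ≤ suc v) →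
      (∀ a → e ≤ spokes (residue a) L + rims (residue a) L
           × spokes (residue a) L + rims (residue a) L ≤ suc e) →
      IsℤCordial m (F j)
    cordial refl v e boundV boundE = labeling , λ a₁ a₂ → closeV a₁ a₂ , closeE a₁ a₂
      where
      closeV : ∀ a₁ a₂ → ∣ f-V labeling a₁ - f-V labeling a₂ ∣ ≤ 1
      closeV a₁ a₂ rewrite f-V≡ a₁ | f-V≡ a₂ =
        ∣m-n∣≤1 (proj₁ (boundV a₁)) (proj₂ (boundV a₁)) (proj₁ (boundV a₂)) (proj₂ (boundV a₂))
      closeE : ∀ a₁ a₂ → ∣ f-E labeling a₁ - f-E labeling a₂ ∣ ≤ 1
      closeE a₁ a₂ rewrite f-E≡ a₁ | f-E≡ a₂ =
        ∣m-n∣≤1 (proj₁ (boundE a₁)) (proj₂ (boundE a₁)) (proj₁ (boundE a₂)) (proj₂ (boundE a₂))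

-- Odd numbers of triangles

-- Here j = 2q + 1, and 2t + ε is the excess m - (2j + 1). Starting at t + 1, the outer labels leave
-- t nonzero residues free below them and t + ε above.
block-spokes≤1 : ∀ m .{{_ : NonZero m}} q t ε → 4 * q + 3 + 2 * t + ε ≡ m → ∀ a →
                 residue m a 0 + spokes (residue m a) (block (suc t) q) ≤ 1
block-spokes≤1 m q t ε refl a rewrite spokes-block (residue m a) (suc t) q =
  Residue.centre+window≤1 m a (suc t) (4 * q + 2) (s≤s z≤n)
    (≤-offset (t + ε) (solve (t ∷ q ∷ ε ∷ [])))

-- Moving a block by 1 moves its sums by 2, so the start decides where they fall. From t + 1 they
-- sit in the middle of the complement of the outer labels, with gaps t - q before them and t + ε -
-- q after.
odd-cordial-sparse : ∀ m .{{_ : NonZero m}} q t ε → q ≤ t → 4 * q + 3 + 2 * t + ε ≡ m →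
                     IsℤCordial m (F (2 * q + 1))
odd-cordial-sparse m q t ε q≤t m≡ with m≤n⇒∃[o]m+o≡n q≤t
odd-cordial-sparse m q t ε _ refl | d , refl =
  cordial m L (length-block (suc t) q) 0 0
    (λ a → z≤n , block-spokes≤1 m q t ε refl a) (λ a → z≤n , edges≤1 a)
  where
  L = block (suc t) q
  edges≤1 : ∀ a → spokes (residue m a) L + rims (residue m a) L ≤ 1
  edges≤1 a rewrite spokes-block (residue m a) (suc t) q | rims-block (residue m a) (suc t) q =
    Residue.disjoint m a (suc t) (4 * q + 2) (2 * suc t + 3 * q + 1) (2 * q + 1)
      (≤-offset d (solve (d ∷ q ∷ []))) (≤-offset (d + ε) (solve (d ∷ q ∷ ε ∷ [])))

-- The two gaps have turned into overlaps, of q - t and q - t - ε residues, so the sums reach the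
-- outer labels at both ends.
odd-cordial-dense : ∀ m .{{_ : NonZero m}} q t ε → t + ε ≤ q → 4 * q + 3 + 2 * t + ε ≡ m →
                    IsℤCordial m (F (2 * q + 1))
odd-cordial-dense m q t ε t+ε≤q m≡ with m≤n⇒∃[o]m+o≡n t+ε≤q
odd-cordial-dense m q t ε _ refl | d , refl =
  cordial m L (length-block (suc t) q) 0 1
    (λ a → z≤n , block-spokes≤1 m q t ε refl a) edges
  where
  L = block (suc t) q
  edges : ∀ a → 1 ≤ spokes (residue m a) L + rims (residue m a) L
              × spokes (residue m a) L + rims (residue m a) L ≤ 2
  edges a rewrite spokes-block (residue m a) (suc t) q | rims-block (residue m a) (suc t) q =
    covering (suc t) (4 * q + 2) (2 * suc t + 3 * q + 1) (2 * q + 1)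
      s≤m (≤-offset (ε + d) (solve (t ∷ ε ∷ d ∷ []))) (≤-offset d (solve (t ∷ ε ∷ d ∷ []))) ,
    +-mono-≤ (window≤1 (suc t) s≤m) (window≤1 (2 * suc t + 3 * q + 1) n≤m)
    where
    open Residue m a
    s≤m : 4 * q + 2 ≤ m
    s≤m = ≤-offset (2 * t + ε + 1) (solve (t ∷ ε ∷ d ∷ []))
    n≤m : 2 * q + 1 ≤ m
    n≤m = ≤-offset (2 * q + 2 + 2 * t + ε) (solve (t ∷ ε ∷ d ∷ []))

odd-cordial : ∀ m .{{_ : NonZero m}} q t ε → ε ≤ 1 → 4 * q + 3 + 2 * t + ε ≡ m →
              IsℤCordial m (F (2 * q + 1))
odd-cordial m q t ε ε≤1 m≡ with ≤-<-connex q t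
... | inj₁ q≤t = odd-cordial-sparse m q t ε q≤t m≡
... | inj₂ t<q = odd-cordial-dense m q t ε
  (≤-trans (+-monoʳ-≤ t ε≤1) (≤-trans (≤-reflexive (+-comm t 1)) t<q)) m≡

-- Even numbers of triangles

-- One more pair flanks the block, so that all outer labels still form an interval.
even-cordial-dense : ∀ m .{{_ : NonZero m}} q t ε → ε ≤ 1 → t + ε ≤ q → 4 * q + 5 + 2 * t + ε ≡ m →
                     IsℤCordial m (F (2 * q + 2))
even-cordial-dense m q t ε ε≤1 t+ε≤q m≡ with m≤n⇒∃[o]m+o≡n t+ε≤q
even-cordial-dense m q t ε ε≤1 _ refl | d , refl =
  cordial m L (trans (cong suc (length-block (2 + t) q)) (sym (+-suc (2 * q) 1))) 0 1
    (λ a → z≤n , vertices≤1 a) edges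
  where
  L = (suc t , t + 4 * q + 4) ∷ block (2 + t) q

  spokes≡ : ∀ w → spokes w L ≡ window w (suc t) (4 * q + 4)
  spokes≡ w = begin
    w (suc t) + w (t + 4 * q + 4) + spokes w (block (2 + t) q)
      ≡⟨ cong (w (suc t) + w (t + 4 * q + 4) +_) (spokes-block w (2 + t) q) ⟩
    w (suc t) + w (t + 4 * q + 4) + window w (2 + t) (4 * q + 2)
      ≡⟨ regroup (w (suc t)) (w (t + 4 * q + 4)) (window w (2 + t) (4 * q + 2)) ⟩
    w (suc t) + (window w (2 + t) (4 * q + 2) + window w (t + 4 * q + 4) 1)
      ≡⟨ cong (w (suc t) +_) (glue w (4 * q + 2) 1 (solve (t ∷ ε ∷ d ∷ []))) ⟩
    window w (suc t) (1 + (4 * q + 2 + 1))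
      ≡⟨ cong (window w (suc t)) (length≡ q) ⟩
    window w (suc t) (4 * q + 4) ∎
    where
    open ≡-Reasoning
    regroup : ∀ a b c → a + b + c ≡ a + (c + (b + 0))
    regroup = solve-∀
    length≡ : ∀ q → 1 + (4 * q + 2 + 1) ≡ 4 * q + 4
    length≡ = solve-∀

  vertices≤1 : ∀ a → residue m a 0 + spokes (residue m a) L ≤ 1
  vertices≤1 a rewrite spokes≡ (residue m a) =
    Residue.centre+window≤1 m a (suc t) (4 * q + 4) (s≤s z≤n)
      (≤-offset (t + ε) (solve (t ∷ ε ∷ d ∷ [])))

  edges : ∀ a → 1 ≤ spokes (residue m a) L + rims (residue m a) L
              × spokes (residue m a) L + rims (residue m a) L ≤ 2
  edges a rewrite spokes≡ (residue m a) | rims-block (residue m a) (2 + t) q = lower , upper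
    where
    open Residue m a
    w = residue m a
    e = w (suc t + (t + 4 * q + 4))
    S = window w (suc t) (4 * q + 4)
    I = window w (2 * (2 + t) + 3 * q + 1) (2 * q + 1)

    s≤m : 4 * q + 4 ≤ m
    s≤m = ≤-offset (2 * t + ε + 1) (solve (t ∷ ε ∷ d ∷ []))
    n≤m : 2 * q + 1 ≤ m
    n≤m = ≤-offset (2 * q + 4 + 2 * t + ε) (solve (t ∷ ε ∷ d ∷ []))

    -- The block's sums alone cover what `S` leaves out, with the same overlaps as for odd j.
    lower : 1 ≤ S + (e + I)
    lower = ≤-trans
      (covering (suc t) (4 * q + 4) (2 * (2 + t) + 3 * q + 1) (2 * q + 1) s≤m
        (≤-offset (ε + d) (solve (t ∷ ε ∷ d ∷ []))) (≤-offset d (solve (t ∷ ε ∷ d ∷ []))))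
      (+-monoʳ-≤ S (m≤n+m I e))

    -- The flanking pair has sum m - ε, which is no outer label, so `S` and `e` together count at
    -- most 1.
    upper : S + (e + I) ≤ 2
    upper = begin
      S + (e + I)              ≡⟨ +-assoc S e I ⟨
      S + e + I                ≡⟨ cong (λ x → S + x + I) (sym (window-singleton w (suc t + (t + 4 * q + 4)))) ⟩
      S + window w (suc t + (t + 4 * q + 4)) 1 + I       ≤⟨ +-mono-≤
        (disjoint (suc t) (4 * q + 4) (suc t + (t + 4 * q + 4)) 1
          (≤-offset t (solve (t ∷ ε ∷ d ∷ []))) (≤-offset (t + ε) (solve (t ∷ ε ∷ d ∷ []))))
        (window≤1 (2 * (2 + t) + 3 * q + 1) n≤m) ⟩
      2 ∎
      where open ≤-Reasoning

-- Here the outer labels form an interval with one gap, which compensates for the equal parities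
-- of the sums of the inner and of the outer pairs.
even-cordial-sparse : ∀ m .{{_ : NonZero m}} p r → 1 ≤ p → 6 * p + 1 + r ≡ m → IsℤCordial m (F (2 * p))
even-cordial-sparse m p r 1≤p refl =
  cordial m L length≡ 0 0 (λ a → z≤n , vertices≤1 a) (λ a → z≤n , edges≤1 a)
  where
  -- The gap is at 4p + 1. From a start u the outer labels would end at u + 4p and the sums begin at
  -- 2u + 3p; u = p + 1 makes them abut. Labels, gap and sums then fill 3j + 1 consecutive integers,
  -- which fit into a period because m > 3j.
  L = parallel (suc p) (4 * p + 2) p ++ parallel (2 * p + 1) (3 * p + 1) p

  length≡ : length L ≡ 2 * p
  length≡ = trans (length-++ (parallel (suc p) (4 * p + 2) p))
    (cong₂ _+_ (length-parallel (suc p) (4 * p + 2) p)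
      (trans (length-parallel (2 * p + 1) (3 * p + 1) p) (sym (+-identityʳ p))))

  spokes≡ : ∀ w → spokes w L ≡ window w (suc p) (3 * p) + window w (4 * p + 2) p
  spokes≡ w = begin
    spokes w L
      ≡⟨ spokes-++ w (parallel (suc p) (4 * p + 2) p) _ ⟩
    _ ≡⟨ cong₂ _+_ (spokes-parallel w (suc p) (4 * p + 2) p)
                   (spokes-parallel w (2 * p + 1) (3 * p + 1) p) ⟩
    (window w (suc p) p + window w (4 * p + 2) p) + (window w (2 * p + 1) p + window w (3 * p + 1) p)
      ≡⟨ regroup (window w (suc p) p) _ (window w (2 * p + 1) p) _ ⟩
    window w (suc p) p + (window w (2 * p + 1) p + window w (3 * p + 1) p) + window w (4 * p + 2) p
      ≡⟨ cong (_+ window w (4 * p + 2) p)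
           (glue′ w p (p + p) (next₁ p) (glue w p p (next₂ p))) ⟩
    window w (suc p) (p + (p + p)) + window w (4 * p + 2) p
      ≡⟨ cong (λ n → window w (suc p) (p + (p + n)) + window w (4 * p + 2) p) (+-identityʳ p) ⟨
    window w (suc p) (3 * p) + window w (4 * p + 2) p ∎
    where
    open ≡-Reasoning
    regroup : ∀ a b c d → a + b + (c + d) ≡ a + (c + d) + b
    regroup = solve-∀
    next₁ : ∀ p → suc p + p ≡ 2 * p + 1
    next₁ = solve-∀
    next₂ : ∀ p → 2 * p + 1 + p ≡ 3 * p + 1
    next₂ = solve-∀

  rims≡ : ∀ w → rims w L ≡ window w (5 * p + 2) (p + p)
  rims≡ w = begin
    rims w L
      ≡⟨ rims-++ w (parallel (suc p) (4 * p + 2) p) _ ⟩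
    _ ≡⟨ cong₂ _+_ (rims-parallel w (suc p) (4 * p + 2) p)
                   (rims-parallel w (2 * p + 1) (3 * p + 1) p) ⟩
    stride2 w (suc p + (4 * p + 2)) p + stride2 w (2 * p + 1 + (3 * p + 1)) p
      ≡⟨ cong₂ (λ b c → stride2 w b p + stride2 w c p) (outer-sum p) (inner-sum p) ⟩
    stride2 w (suc (5 * p + 2)) p + stride2 w (5 * p + 2) p
      ≡⟨ +-comm (stride2 w (suc (5 * p + 2)) p) _ ⟩
    stride2 w (5 * p + 2) p + stride2 w (suc (5 * p + 2)) p
      ≡⟨ interleave-even w (5 * p + 2) p ⟩
    window w (5 * p + 2) (p + p) ∎
    where
    open ≡-Reasoning
    outer-sum : ∀ p → suc p + (4 * p + 2) ≡ suc (5 * p + 2)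
    outer-sum = solve-∀
    inner-sum : ∀ p → 2 * p + 1 + (3 * p + 1) ≡ 5 * p + 2
    inner-sum = solve-∀

  vertices≤1 : ∀ a → residue m a 0 + spokes (residue m a) L ≤ 1
  vertices≤1 a = begin
    w 0 + spokes w L
      ≡⟨ cong (w 0 +_) (spokes≡ w) ⟩
    w 0 + (window w (suc p) (3 * p) + window w (4 * p + 2) p)
      -- Filling the gap can only raise the count, and makes the outer labels a single window.
      ≤⟨ +-monoʳ-≤ (w 0) (+-monoʳ-≤ _ (window-mono w p (suc p)
           (≤-offset 1 (lower p)) (≤-reflexive (upper p)))) ⟩
    w 0 + (window w (suc p) (3 * p) + window w (4 * p + 1) (suc p))
      ≡⟨ cong (w 0 +_) (glue w (3 * p) (suc p) (middle p)) ⟩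
    w 0 + window w (suc p) (3 * p + suc p)
      ≤⟨ Residue.centre+window≤1 m a (suc p) (3 * p + suc p) (s≤s z≤n)
           (≤-trans (≤-reflexive (end p)) (≤-trans (+-monoʳ-≤ (5 * p + 1) 1≤p) (≤-offset r (bound p r)))) ⟩
    1 ∎
    where
    open ≤-Reasoning
    w = residue m a
    lower : ∀ p → 4 * p + 1 + 1 ≡ 4 * p + 2
    lower = solve-∀
    upper : ∀ p → 4 * p + 2 + p ≡ 4 * p + 1 + suc p
    upper = solve-∀
    middle : ∀ p → suc p + 3 * p ≡ 4 * p + 1
    middle = solve-∀
    end : ∀ p → suc p + (3 * p + suc p) ≡ 5 * p + 1 + 1
    end = solve-∀
    bound : ∀ p r → 5 * p + 1 + p + r ≡ 6 * p + 1 + r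
    bound = solve-∀

  edges≤1 : ∀ a → spokes (residue m a) L + rims (residue m a) L ≤ 1
  edges≤1 a = begin
    spokes w L + rims w L
      ≡⟨ cong₂ _+_ (spokes≡ w) (rims≡ w) ⟩
    window w (suc p) (3 * p) + window w (4 * p + 2) p + window w (5 * p + 2) (p + p)
      ≡⟨ +-assoc (window w (suc p) (3 * p)) _ _ ⟩
    window w (suc p) (3 * p) + (window w (4 * p + 2) p + window w (5 * p + 2) (p + p))
      ≡⟨ cong (window w (suc p) (3 * p) +_) (glue w p (p + p) (solve (p ∷ []))) ⟩
    window w (suc p) (3 * p) + window w (4 * p + 2) (p + (p + p))
      ≤⟨ Residue.disjoint m a (suc p) (3 * p) (4 * p + 2) (p + (p + p))
           (≤-offset 1 (solve (p ∷ []))) (≤-offset r (solve (p ∷ r ∷ []))) ⟩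
    1 ∎
    where
    open ≤-Reasoning
    w = residue m a

-- With 2j + 1 = m + 1 vertices exactly one label is repeated; it is q + 2.
even-cordial-full : ∀ m .{{_ : NonZero m}} q → 1 ≤ q → 4 * q + 4 ≡ m → IsℤCordial m (F (2 * q + 2))
even-cordial-full m q 1≤q refl =
  cordial m L (trans (cong suc (length-block 2 q)) (sym (+-suc (2 * q) 1))) 1 1 vertices edges
  where
  -- The block's sums run from 3q + 5 to m + q + 1. Hence `q + 2` and the new sum q + 3 are the two
  -- residues next after them, and neither is counted a third time.
  L = (1 , q + 2) ∷ block 2 q

  length≡ : 1 + (4 * q + 3) ≡ m
  length≡ = solve (q ∷ [])

  spokes≡ : ∀ w → spokes w L ≡ window w 1 (4 * q + 3) + w (q + 2)
  spokes≡ w = begin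
    w 1 + w (q + 2) + spokes w (block 2 q)     ≡⟨ cong (w 1 + w (q + 2) +_) (spokes-block w 2 q) ⟩
    w 1 + w (q + 2) + window w 2 (4 * q + 2)   ≡⟨ regroup (w 1) (w (q + 2)) _ ⟩
    window w 1 (1 + (4 * q + 2)) + w (q + 2)   ≡⟨ cong (λ n → window w 1 n + w (q + 2)) (sym (+-suc (4 * q) 2)) ⟩
    window w 1 (4 * q + 3) + w (q + 2)         ∎
    where
    open ≡-Reasoning
    regroup : ∀ a b c → a + b + c ≡ a + c + b
    regroup = solve-∀

  vertices≡ : ∀ a → residue m a 0 + spokes (residue m a) L ≡ 1 + residue m a (q + 2)
  vertices≡ a = begin
    w 0 + spokes w L                            ≡⟨ cong (w 0 +_) (spokes≡ w) ⟩
    w 0 + (window w 1 (4 * q + 3) + w (q + 2))  ≡⟨ +-assoc (w 0) _ _ ⟨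
    window w 0 (1 + (4 * q + 3)) + w (q + 2)    ≡⟨ cong (λ n → window w 0 n + w (q + 2)) length≡ ⟩
    window w 0 m + w (q + 2)                    ≡⟨ cong (_+ w (q + 2)) (window-residue m a 0) ⟩
    1 + w (q + 2)                               ∎
    where
    open ≡-Reasoning
    w = residue m a

  vertices : ∀ a → 1 ≤ residue m a 0 + spokes (residue m a) L
                 × residue m a 0 + spokes (residue m a) L ≤ 2
  vertices a rewrite vertices≡ a = m≤m+n 1 _ , +-monoʳ-≤ 1 (Residue.value≤1 m a (q + 2))

  edges : ∀ a → 1 ≤ spokes (residue m a) L + rims (residue m a) L
              × spokes (residue m a) L + rims (residue m a) L ≤ 2
  edges a rewrite spokes≡ (residue m a) | rims-block (residue m a) 2 q = lower , upper
    where
    open Residue m a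
    w = residue m a
    S = window w 1 (4 * q + 3)
    I = window w (2 * 2 + 3 * q + 1) (2 * q + 1)
    s≤m : 4 * q + 3 ≤ m
    s≤m = ≤-trans (n≤1+n _) (≤-reflexive length≡)

    -- Only the residue 0 is missing from `S`; since q ≥ 1, the block's sums pass through m.
    lower : 1 ≤ S + w (q + 2) + (w (1 + (q + 2)) + I)
    lower = ≤-trans
      (covering 1 (4 * q + 3) (2 * 2 + 3 * q + 1) (2 * q + 1) s≤m
        (≤-trans (≤-reflexive (start q)) (≤-trans (+-monoʳ-≤ (3 * q + 4) 1≤q) (≤-reflexive (start′ q))))
        (≤-trans (≤-reflexive (end q)) (≤-trans (+-monoʳ-≤ (4 * q + 4) 1≤q) (≤-offset 2 (end′ q)))))
      (+-mono-≤ (m≤m+n S _) (m≤n+m I _))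
      where
      start : ∀ q → 2 * 2 + 3 * q + 1 ≡ 3 * q + 4 + 1
      start = solve-∀
      start′ : ∀ q → 3 * q + 4 + q ≡ 1 + (4 * q + 3)
      start′ = solve-∀
      end : ∀ q → 1 + (4 * q + 4) ≡ 4 * q + 4 + 1
      end = solve-∀
      end′ : ∀ q → 4 * q + 4 + q + 2 ≡ 2 * 2 + 3 * q + 1 + (2 * q + 1)
      end′ = solve-∀

    upper : S + w (q + 2) + (w (1 + (q + 2)) + I) ≤ 2
    upper = begin
      S + w (q + 2) + (w (1 + (q + 2)) + I)
        ≡⟨ regroup S (w (q + 2)) (w (1 + (q + 2))) I ⟩
      S + (window w (q + 2) 2 + I)
        ≤⟨ +-mono-≤ (window≤1 1 s≤m) (disjoint (q + 2) 2 (2 * 2 + 3 * q + 1) (2 * q + 1)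
             (≤-offset (2 * q + 1) (solve (q ∷ []))) (≤-reflexive (solve (q ∷ [])))) ⟩
      2 ∎
      where
      open ≤-Reasoning
      regroup : ∀ a b c d → a + b + (c + d) ≡ a + (b + (c + 0) + d)
      regroup = solve-∀

-- The exact partition for m = 3j with 4 dividing j

-- The Skolem sequence of order 4s, s = σ + 2, whose pairs (a , b) of positions at distance b - a = i
-- are turned into the sums i + (a + 4s) = b + 4s; modulo 12s these partition all residues.
skolem-cordial : ∀ m .{{_ : NonZero m}} σ → 12 * σ + 24 ≡ m → IsℤCordial m (F (4 * σ + 8))
skolem-cordial m σ refl = cordial m L length≡ 0 0 (λ a → z≤n , vertices≤1 a) (λ a → z≤n , edges≤1 a)
  where
  -- The distances 1, 2s - 1 and 4s - 1 are placed singly. `B` carries 3, 5, ..., 2s - 3 and `A`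
  -- carries 2s + 1, ..., 4s - 3; `P` joins the positions 6s - k and 6s + k for each even distance
  -- 2k.
  B A P : Triangles
  B = steep 3 (5 * σ + 12) σ
  A = steep (2 * σ + 5) (4 * σ + 9) (σ + 1)
  P = steep 2 (8 * σ + 16) (2 * σ + 4)
  L = (1 , 5 * σ + 10) ∷ (2 * σ + 3 , 6 * σ + 12) ∷ (4 * σ + 7 , 6 * σ + 13) ∷ B ++ A ++ P

  length≡ : length L ≡ 4 * σ + 8
  length≡ = begin
    3 + length (B ++ A ++ P)
      ≡⟨ cong (3 +_) (trans (length-++ B) (cong (length B +_) (length-++ A))) ⟩
    3 + (length B + (length A + length P))
      ≡⟨ cong (3 +_) (cong₂ _+_ (length-steep 3 (5 * σ + 12) σ)
           (cong₂ _+_ (length-steep (2 * σ + 5) (4 * σ + 9) (σ + 1))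
                      (length-steep 2 (8 * σ + 16) (2 * σ + 4)))) ⟩
    3 + (σ + (σ + 1 + (2 * σ + 4)))
      ≡⟨ total σ ⟩
    4 * σ + 8 ∎
    where
    open ≡-Reasoning
    total : ∀ σ → 3 + (σ + (σ + 1 + (2 * σ + 4))) ≡ 4 * σ + 8
    total = solve-∀

  module _ (w : ℕ → ℕ) where
    bx = stride2 w 3 σ
    by = window w (5 * σ + 12) σ
    bz = window w (6 * σ + 14) σ
    ax = stride2 w (2 * σ + 5) (σ + 1)
    ay = window w (4 * σ + 9) (σ + 1)
    az = window w (7 * σ + 14) (σ + 1)
    px = stride2 w 2 (2 * σ + 4)
    py = window w (8 * σ + 16) (2 * σ + 4)
    pz = window w (10 * σ + 21) (2 * σ + 4)

    spokes≡ : spokes w L ≡ w 1 + w (5 * σ + 10) + (w (2 * σ + 3) + w (6 * σ + 12)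
              + (w (4 * σ + 7) + w (6 * σ + 13) + ((bx + by) + ((ax + ay) + (px + py)))))
    spokes≡ = cong (λ x → w 1 + w (5 * σ + 10) + (w (2 * σ + 3) + w (6 * σ + 12)
                            + (w (4 * σ + 7) + w (6 * σ + 13) + x)))
      (trans (spokes-++ w B (A ++ P)) (cong₂ _+_ (spokes-steep w 3 (5 * σ + 12) σ)
        (trans (spokes-++ w A P) (cong₂ _+_ (spokes-steep w (2 * σ + 5) (4 * σ + 9) (σ + 1))
                                            (spokes-steep w 2 (8 * σ + 16) (2 * σ + 4))))))

    rims≡ : rims w L ≡ w (5 * σ + 11) + (w (8 * σ + 15) + (w (10 * σ + 20) + (bz + (az + pz))))
    rims≡ = cong₂ _+_ (cong w (z₁ σ)) (cong₂ _+_ (cong w (z₂ σ)) (cong₂ _+_ (cong w (z₃ σ))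
      (trans (rims-++ w B (A ++ P)) (cong₂ _+_ (rims-steep w 3 (5 * σ + 12) σ (zb σ))
        (trans (rims-++ w A P) (cong₂ _+_ (rims-steep w (2 * σ + 5) (4 * σ + 9) (σ + 1) (za σ))
                                          (rims-steep w 2 (8 * σ + 16) (2 * σ + 4) (zp σ))))))))
      where
      z₁ : ∀ σ → 1 + (5 * σ + 10) ≡ 5 * σ + 11
      z₁ = solve-∀
      z₂ : ∀ σ → 2 * σ + 3 + (6 * σ + 12) ≡ 8 * σ + 15
      z₂ = solve-∀
      z₃ : ∀ σ → 4 * σ + 7 + (6 * σ + 13) ≡ 10 * σ + 20
      z₃ = solve-∀
      zb : ∀ σ → 3 + (5 * σ + 12) + σ ≡ suc (6 * σ + 14)
      zb = solve-∀
      za : ∀ σ → 2 * σ + 5 + (4 * σ + 9) + (σ + 1) ≡ suc (7 * σ + 14)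
      za = solve-∀
      zp : ∀ σ → 2 + (8 * σ + 16) + (2 * σ + 4) ≡ suc (10 * σ + 21)
      zp = solve-∀

    -- The odd distances come from the single pairs, `B` and `A`, the even ones from `P`; together
    -- they are 1, ..., 4s.
    differences : w 1 + (bx + (w (2 * σ + 3) + (ax + w (4 * σ + 7)))) + px
                  ≡ window w 1 (2 * σ + 4 + (2 * σ + 4))
    differences = begin
      w 1 + (bx + (w (2 * σ + 3) + (ax + w (4 * σ + 7)))) + px
        ≡⟨ cong (λ x → w 1 + (bx + (w (2 * σ + 3) + (ax + x))) + px) (sym (+-identityʳ _)) ⟩
      w 1 + (bx + (w (2 * σ + 3) + (ax + stride2 w (4 * σ + 7) 1))) + px
        ≡⟨ cong (λ x → w 1 + (bx + (w (2 * σ + 3) + x)) + px) (stride2-glue w (σ + 1) 1 (solve (σ ∷ []))) ⟩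
      w 1 + (bx + (w (2 * σ + 3) + stride2 w (2 * σ + 5) (σ + 1 + 1))) + px
        ≡⟨ cong (λ c → w 1 + (bx + (w (2 * σ + 3) + stride2 w c (σ + 1 + 1))) + px) (next σ) ⟩
      w 1 + (bx + stride2 w (2 * σ + 3) (1 + (σ + 1 + 1))) + px
        ≡⟨ cong (λ x → w 1 + x + px) (stride2-glue w σ (1 + (σ + 1 + 1)) (solve (σ ∷ []))) ⟩
      stride2 w 1 (1 + (σ + (1 + (σ + 1 + 1)))) + px
        ≡⟨ cong (λ n → stride2 w 1 n + px) (count σ) ⟩
      stride2 w 1 (2 * σ + 4) + px
        ≡⟨ interleave-even w 1 (2 * σ + 4) ⟩
      window w 1 (2 * σ + 4 + (2 * σ + 4)) ∎
      where
      open ≡-Reasoning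
      next : ∀ σ → 2 * σ + 5 ≡ suc (suc (2 * σ + 3))
      next = solve-∀
      count : ∀ σ → 1 + (σ + (1 + (σ + 1 + 1))) ≡ 2 * σ + 4
      count = solve-∀

    partition : spokes w L + rims w L ≡ window w 1 m
    partition = begin
      spokes w L + rims w L
        ≡⟨ cong₂ _+_ spokes≡ rims≡ ⟩
      _ ≡⟨ regroup (w 1) (w (5 * σ + 10)) (w (2 * σ + 3)) (w (6 * σ + 12)) (w (4 * σ + 7)) (w (6 * σ + 13))
             bx by ax ay px py (w (5 * σ + 11)) (w (8 * σ + 15)) (w (10 * σ + 20)) bz az pz ⟩
      w 1 + (bx + (w (2 * σ + 3) + (ax + w (4 * σ + 7)))) + px
        + (ay + (window w (5 * σ + 10) 1 + (window w (5 * σ + 11) 1 + (by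
        + (window w (6 * σ + 12) 1 + (window w (6 * σ + 13) 1 + (bz + (az
        + (window w (8 * σ + 15) 1 + (py + (window w (10 * σ + 20) 1 + pz)))))))))))
        ≡⟨ cong₂ _+_ differences positions ⟩
      window w 1 (2 * σ + 4 + (2 * σ + 4)) + window w (4 * σ + 9) k₁
        ≡⟨ glue w (2 * σ + 4 + (2 * σ + 4)) k₁ (e₁ σ) ⟩
      window w 1 (2 * σ + 4 + (2 * σ + 4) + k₁)
        ≡⟨ cong (window w 1) (total σ) ⟩
      window w 1 m ∎
      where
      open ≡-Reasoning
      regroup : ∀ w₁ a₁ d₂ a₂ d₃ a₃ bx by ax ay px py c₁ c₂ c₃ bz az pz →
        w₁ + a₁ + (d₂ + a₂ + (d₃ + a₃ + ((bx + by) + ((ax + ay) + (px + py)))))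
          + (c₁ + (c₂ + (c₃ + (bz + (az + pz)))))
        ≡ w₁ + (bx + (d₂ + (ax + d₃))) + px
          + (ay + ((a₁ + 0) + ((c₁ + 0) + (by + ((a₂ + 0) + ((a₃ + 0) + (bz + (az
          + ((c₂ + 0) + (py + ((c₃ + 0) + pz)))))))))))
      regroup = solve-∀
      k₁₂ = 2 * σ + 4
      k₁₁ = 1 + k₁₂
      k₁₀ = 2 * σ + 4 + k₁₁
      k₉ = 1 + k₁₀
      k₈ = σ + 1 + k₉
      k₇ = σ + k₈
      k₆ = 1 + k₇
      k₅ = 1 + k₆
      k₄ = σ + k₅
      k₃ = 1 + k₄
      k₂ = 1 + k₃
      k₁ = σ + 1 + k₂
      e₁ : ∀ σ → 1 + (2 * σ + 4 + (2 * σ + 4)) ≡ 4 * σ + 9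
      e₁ = solve-∀
      e₂ : ∀ σ → 4 * σ + 9 + (σ + 1) ≡ 5 * σ + 10
      e₂ = solve-∀
      e₃ : ∀ σ → 5 * σ + 10 + 1 ≡ 5 * σ + 11
      e₃ = solve-∀
      e₄ : ∀ σ → 5 * σ + 11 + 1 ≡ 5 * σ + 12
      e₄ = solve-∀
      e₅ : ∀ σ → 5 * σ + 12 + σ ≡ 6 * σ + 12
      e₅ = solve-∀
      e₆ : ∀ σ → 6 * σ + 12 + 1 ≡ 6 * σ + 13
      e₆ = solve-∀
      e₇ : ∀ σ → 6 * σ + 13 + 1 ≡ 6 * σ + 14
      e₇ = solve-∀
      e₈ : ∀ σ → 6 * σ + 14 + σ ≡ 7 * σ + 14
      e₈ = solve-∀
      e₉ : ∀ σ → 7 * σ + 14 + (σ + 1) ≡ 8 * σ + 15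
      e₉ = solve-∀
      e₁₀ : ∀ σ → 8 * σ + 15 + 1 ≡ 8 * σ + 16
      e₁₀ = solve-∀
      e₁₁ : ∀ σ → 8 * σ + 16 + (2 * σ + 4) ≡ 10 * σ + 20
      e₁₁ = solve-∀
      e₁₂ : ∀ σ → 10 * σ + 20 + 1 ≡ 10 * σ + 21
      e₁₂ = solve-∀
      positions : ay + (window w (5 * σ + 10) 1 + (window w (5 * σ + 11) 1 + (by
        + (window w (6 * σ + 12) 1 + (window w (6 * σ + 13) 1 + (bz + (az
        + (window w (8 * σ + 15) 1 + (py + (window w (10 * σ + 20) 1 + pz))))))))))
        ≡ window w (4 * σ + 9) k₁
      -- From left to right: left ends of `A`, both ends of distance 1, left ends of `B`, of 2s - 1
      -- and of 4s - 1, right ends of `B`, of `A` and of 2s - 1, then left ends of `P`, the right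
      -- end of 4s - 1 at 6s, and right ends of `P`.
      positions = glue′ w {4 * σ + 9} {5 * σ + 10} (σ + 1) k₂ (e₂ σ) 
        (glue′ w {5 * σ + 10} {5 * σ + 11} 1 k₃ (e₃ σ) 
        (glue′ w {5 * σ + 11} {5 * σ + 12} 1 k₄ (e₄ σ) 
        (glue′ w {5 * σ + 12} {6 * σ + 12} σ k₅ (e₅ σ) 
        (glue′ w {6 * σ + 12} {6 * σ + 13} 1 k₆ (e₆ σ) 
        (glue′ w {6 * σ + 13} {6 * σ + 14} 1 k₇ (e₇ σ) 
        (glue′ w {6 * σ + 14} {7 * σ + 14} σ k₈ (e₈ σ) 
        (glue′ w {7 * σ + 14} {8 * σ + 15} (σ + 1) k₉ (e₉ σ) 
        (glue′ w {8 * σ + 15} {8 * σ + 16} 1 k₁₀ (e₁₀ σ) 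
        (glue′ w {8 * σ + 16} {10 * σ + 20} (2 * σ + 4) k₁₁ (e₁₁ σ) 
        (glue w {10 * σ + 20} {10 * σ + 21} 1 k₁₂ (e₁₂ σ)))))))))))
      total : ∀ σ → 2 * σ + 4 + (2 * σ + 4) + (σ + 1 + (1 + (1 + (σ + (1 + (1 + (σ + (σ + 1
        + (1 + (2 * σ + 4 + (1 + (2 * σ + 4)))))))))))) ≡ 12 * σ + 24
      total = solve-∀

    -- The centre's label 0 ≡ m is the label of a rim edge, hence not an outer label.
    m-is-a-rim : w m ≤ rims w L
    m-is-a-rim = begin
      w m             ≡⟨ window-singleton w m ⟨
      window w m 1    ≤⟨ window-mono w 1 (2 * σ + 4) (≤-offset (2 * σ + 3) (lower σ)) (≤-reflexive (upper σ)) ⟩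
      pz              ≤⟨ m≤n+m pz az ⟩
      az + pz         ≤⟨ m≤n+m _ bz ⟩
      _               ≤⟨ m≤n+m _ (w (10 * σ + 20)) ⟩
      _               ≤⟨ m≤n+m _ (w (8 * σ + 15)) ⟩
      _               ≤⟨ m≤n+m _ (w (5 * σ + 11)) ⟩
      _               ≡⟨ rims≡ ⟨
      rims w L        ∎
      where
      open ≤-Reasoning
      lower : ∀ σ → 10 * σ + 21 + (2 * σ + 3) ≡ 12 * σ + 24
      lower = solve-∀
      upper : ∀ σ → 12 * σ + 24 + 1 ≡ 10 * σ + 21 + (2 * σ + 4)
      upper = solve-∀

  edges≤1 : ∀ a → spokes (residue m a) L + rims (residue m a) L ≤ 1
  edges≤1 a = ≤-reflexive (trans (partition (residue m a)) (window-residue m a 1))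

  vertices≤1 : ∀ a → residue m a 0 + spokes (residue m a) L ≤ 1
  vertices≤1 a = begin
    w 0 + spokes w L        ≡⟨ cong (_+ spokes w L) (residue-periodic m a 0) ⟨
    w m + spokes w L        ≤⟨ +-monoˡ-≤ (spokes w L) (m-is-a-rim w) ⟩
    rims w L + spokes w L   ≡⟨ +-comm (rims w L) _ ⟩
    spokes w L + rims w L   ≤⟨ edges≤1 a ⟩
    1                       ∎
    where
    open ≤-Reasoning
    w = residue m a

-- The Skolem sequence 1 1 3 4 2 3 2 4 of order 4. In the general pattern the single distances 1 and
-- 2s - 1 would coincide for s = 1.
F₄-ℤ₁₂-cordial : IsℤCordial 12 (F 4)
F₄-ℤ₁₂-cordial = cordial 12 L refl 0 0
  (toWitness {a? = all? λ a → (0 ≤? vertices a) ×-dec (vertices a ≤? 1)} tt)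
  (toWitness {a? = all? λ a → (0 ≤? edges a) ×-dec (edges a ≤? 1)} tt)
  where
  L = (1 , 5) ∷ (2 , 9) ∷ (3 , 7) ∷ (4 , 8) ∷ []
  vertices edges : Fin 12 → ℕ
  vertices a = residue 12 a 0 + spokes (residue 12 a) L
  edges a = spokes (residue 12 a) L + rims (residue 12 a) L

-- Division into cases

F₀-cordial : ∀ m .{{_ : NonZero m}} → IsℤCordial m (F 0)
F₀-cordial m = cordial m [] refl 0 0
  (λ a → z≤n , ≤-trans (≤-reflexive (+-identityʳ _)) (Residue.value≤1 m a 0)) (λ a → z≤n , z≤n)

halve : ∀ n → ∃₂ λ t ε → ε ≤ 1 × 2 * t + ε ≡ n
halve n = n / 2 , n % 2 , m<1+n⇒m≤n (m%n<n n 2) ,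
  trans (cong (_+ n % 2) (*-comm 2 (n / 2))) (trans (+-comm _ (n % 2)) (sym (m≡m%n+[m/n]*n n 2)))

-- `t + ε` is half of 2t + ε, rounded up.
half≤ : ∀ t ε q → ε ≤ 1 → 2 * t + ε ≤ 2 * q → t + ε ≤ q
half≤ t ε q ε≤1 h = m<1+n⇒m≤n (*-cancelˡ-< 2 (t + ε) (suc q) (begin
  suc (2 * (t + ε))         ≡⟨ regroup t ε ⟩
  suc (2 * t + ε) + ε       ≤⟨ +-mono-≤ (s≤s h) ε≤1 ⟩
  suc (2 * q) + 1           ≡⟨ next q ⟩
  2 * suc q                 ∎))
  where
  open ≤-Reasoning
  regroup : ∀ t ε → suc (2 * (t + ε)) ≡ suc (2 * t + ε) + ε
  regroup = solve-∀
  next : ∀ q → suc (2 * q) + 1 ≡ 2 * suc q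
  next = solve-∀

even-cordial : ∀ m .{{_ : NonZero m}} q → suc (2 * (2 * q + 2)) ≤ m → m % 12 ≢ 6 → IsℤCordial m (F (2 * q + 2))
even-cordial m q 2j<m m%12≢6 with <-cmp m (6 * q + 6)
... | tri> _ _ m>3j with m≤n⇒∃[o]m+o≡n m>3j
...   | r , m≡ = subst (IsℤCordial m ∘ F) (double q) (even-cordial-sparse m (suc q) r (s≤s z≤n) (trans (size q r) m≡))
  where
  double : ∀ q → 2 * suc q ≡ 2 * q + 2
  double = solve-∀
  size : ∀ q r → 6 * suc q + 1 + r ≡ suc (6 * q + 6) + r
  size = solve-∀
even-cordial m q 2j<m m%12≢6 | tri< m<3j _ _ with m≤n⇒∃[o]m+o≡n 2j<m
... | r , refl with halve r
... | t , ε , ε≤1 , refl = even-cordial-dense m q t ε ε≤1 (half≤ t ε q ε≤1 2t+ε≤2q) (size q t ε)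
  where
  size : ∀ q t ε → 4 * q + 5 + 2 * t + ε ≡ suc (2 * (2 * q + 2)) + (2 * t + ε)
  size = solve-∀
  lhs : ∀ q t ε → 4 * q + 6 + (2 * t + ε) ≡ suc (suc (2 * (2 * q + 2)) + (2 * t + ε))
  lhs = solve-∀
  rhs : ∀ q → 6 * q + 6 ≡ 4 * q + 6 + 2 * q
  rhs = solve-∀
  2t+ε≤2q : 2 * t + ε ≤ 2 * q
  2t+ε≤2q = +-cancelˡ-≤ (4 * q + 6) _ _
    (≤-trans (≤-reflexive (lhs q t ε)) (≤-trans m<3j (≤-reflexive (rhs q))))
even-cordial m q 2j<m m%12≢6 | tri≈ _ refl _ with halve q
-- For q = 2t, j is 2 modulo 4 and m is 6 modulo 12: the parity obstruction.
... | t , 0 , _ , refl = ⊥-elim (m%12≢6 (trans (cong (_% 12) (size t)) ([m+kn]%n≡m%n 6 t 12)))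
  where
  size : ∀ t → 6 * (2 * t + 0) + 6 ≡ 6 + t * 12
  size = solve-∀
... | 0 , 1 , _ , refl = F₄-ℤ₁₂-cordial
... | suc σ , 1 , _ , refl = subst (IsℤCordial m ∘ F) (order σ) (skolem-cordial m σ (size σ))
  where
  order : ∀ σ → 4 * σ + 8 ≡ 2 * (2 * suc σ + 1) + 2
  order = solve-∀
  size : ∀ σ → 12 * σ + 24 ≡ 6 * (2 * suc σ + 1) + 6
  size = solve-∀
... | _ , suc (suc _) , s≤s () , _

cordial-below-half : ∀ m .{{_ : NonZero m}} j → 2 * j < m → m % 12 ≢ 6 → IsℤCordial m (F j)
cordial-below-half m j 2j<m m%12≢6 with halve j
... | 0     , 0 , _ , refl = F₀-cordial m
... | suc q , 0 , _ , refl = subst (IsℤCordial m ∘ F) (order q)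
  (even-cordial m q (subst (λ j → 2 * j < m) (sym (order q)) 2j<m) m%12≢6)
  where
  order : ∀ q → 2 * q + 2 ≡ 2 * suc q + 0
  order = solve-∀
... | q , 1 , _ , refl with m≤n⇒∃[o]m+o≡n 2j<m
...   | r , refl with halve r
...     | t , ε , ε≤1 , refl = odd-cordial m q t ε ε≤1 (size q t ε)
  where
  size : ∀ q t ε → 4 * q + 3 + 2 * t + ε ≡ suc (2 * (2 * q + 1)) + (2 * t + ε)
  size = solve-∀
cordial-below-half m j 2j<m m%12≢6 | _ , suc (suc _) , s≤s () , _

cordial-half : ∀ m .{{_ : NonZero m}} k → k * 12 ≡ m → IsℤCordial m (F (k * 6))
cordial-half m zero    refl = F₀-cordial m
cordial-half m (suc k) refl = subst (IsℤCordial m ∘ F) (order k)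
  (even-cordial-full m (3 * k + 2) (m≤n⇒m≤o+n (3 * k) (s≤s z≤n)) (size k))
  where
  order : ∀ k → 2 * (3 * k + 2) + 2 ≡ suc k * 6
  order = solve-∀
  size : ∀ k → 4 * (3 * k + 2) + 4 ≡ suc k * 12
  size = solve-∀

-- Serves m = 2j with j = r + 6k: such an m is even, and avoiding the five nonzero even residues
-- forces 12 to divide it.
double-mod-12 : ∀ r k → r < 6 → (2 * r + k * 12) % 12 ∉ 2 ∷ 4 ∷ 6 ∷ 8 ∷ 10 ∷ [] → r ≡ 0
double-mod-12 0 k _ _ = refl
double-mod-12 1 k _ h = ⊥-elim (h (here ([m+kn]%n≡m%n 2 k 12)))
double-mod-12 2 k _ h = ⊥-elim (h (there (here ([m+kn]%n≡m%n 4 k 12))))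
double-mod-12 3 k _ h = ⊥-elim (h (there (there (here ([m+kn]%n≡m%n 6 k 12)))))
double-mod-12 4 k _ h = ⊥-elim (h (there (there (there (here ([m+kn]%n≡m%n 8 k 12))))))
double-mod-12 5 k _ h = ⊥-elim (h (there (there (there (there (here ([m+kn]%n≡m%n 10 k 12)))))))
double-mod-12 (suc (suc (suc (suc (suc (suc _)))))) k (s≤s (s≤s (s≤s (s≤s (s≤s (s≤s ())))))) _

theorem10p1 : (m : ℕ) .{{_ : NonZero m}} →
    (m % 12 ∉ 2 ∷ 4 ∷ 6 ∷ 8 ∷ 10 ∷ [] →
    (j : ℕ) → j ≤ m / 2 → IsℤCordial m (F j))
    ×
    (m % 12 ≡ 2 →
    (j : ℕ) → j ≤ m / 2 ∸ 1 → IsℤCordial m (F j))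
theorem10p1 m = up-to-half , below-half
  where
  2[m/2]≤m : 2 * (m / 2) ≤ m
  2[m/2]≤m = ≤-trans (≤-reflexive (*-comm 2 (m / 2))) (m/n*n≤m m 2)

  up-to-half : m % 12 ∉ 2 ∷ 4 ∷ 6 ∷ 8 ∷ 10 ∷ [] → ∀ j → j ≤ m / 2 → IsℤCordial m (F j)
  up-to-half m∉ j j≤m/2 with m≤n⇒m<n∨m≡n (≤-trans (*-monoʳ-≤ 2 j≤m/2) 2[m/2]≤m)
  ... | inj₁ 2j<m = cordial-below-half m j 2j<m (λ m≡6 → m∉ (there (there (here m≡6))))
  ... | inj₂ 2j≡m = subst (IsℤCordial m ∘ F) (sym j≡6k) (cordial-half m k (trans (sym (size k))
                      (trans (cong (2 *_) (sym j≡6k)) 2j≡m)))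
    where
    k = j / 6
    size : ∀ k → 2 * (k * 6) ≡ k * 12
    size = solve-∀
    split : ∀ r k → 2 * (r + k * 6) ≡ 2 * r + k * 12
    split = solve-∀
    m≡ : m ≡ 2 * (j % 6) + k * 12
    m≡ = trans (sym 2j≡m) (trans (cong (2 *_) (m≡m%n+[m/n]*n j 6)) (split (j % 6) k))
    j≡6k : j ≡ k * 6
    j≡6k = trans (m≡m%n+[m/n]*n j 6) (cong (_+ k * 6)
      (double-mod-12 (j % 6) k (m%n<n j 6) (subst (λ n → n % 12 ∉ _) m≡ m∉)))

  below-half : m % 12 ≡ 2 → ∀ j → j ≤ m / 2 ∸ 1 → IsℤCordial m (F j)
  below-half m≡2 j j≤ = cordial-below-half m j (2j<m (m / 2) j≤ 2[m/2]≤m)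
    (λ m≡6 → 2≢6 (trans (sym m≡2) m≡6))
    where
    2≢6 : 2 ≢ 6
    2≢6 ()
    2j<m : ∀ h → j ≤ h ∸ 1 → 2 * h ≤ m → 2 * j < m
    -- At `h` = 0 the truncated `h ∸ 1` still admits j = 0.
    2j<m zero    z≤n _     = >-nonZero⁻¹ m
    2j<m (suc h) j≤h 2h≤m = <-≤-trans (*-monoʳ-< 2 (s≤s j≤h)) 2h≤m
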